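{- Let $k\geq 2$ and $n\geq 3k+3$ be integers, and let $R=r(K_{1,k},K_n)=k(n-1)+1$. If $G$ is a graph with $G\longrightarrow(K_{1,k},K_n)$ and $|V(G)|=R+\ell$ where $0\leq \ell\leq \left\lfloor \frac{kn-2k^{2}}{(k+1)^{2}}\right\rfloor$, then $e(G)\geq \hat{r}^{*}(K_{1,k},K_n)$.
   Context: All graphs are finite and simple; $e(G)$ denotes the number of edges. $K_{1,k}$ is the star with $k$ edges and $K_n$ the complete graph on $n$ vertices. For graphs $F,G,H$, write $F\longrightarrow(G,H)$ if every red-blue colouring of the edges of $F$ yields a red copy of $G$ or a blue copy of $H$. The Ramsey number $r(G,H)$ is the least $N$ with $K_N\longrightarrow(G,H)$. The restricted size Ramsey number is $\hat{r}^{*}(G,H)=\min\{|E(F)| : F\longrightarrow(G,H),\ |V(F)|=r(G,H)\}$. -}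

module Defs where

open import Data.Nat using (ℕ; zero; suc; _+_; _*_; _∸_; _≤_; _<_)
open import Data.Nat.Properties using (_<?_)
open import Data.Bool using (Bool; true; false; _∧_; if_then_else_)
open import Data.Fin using (Fin; toℕ)
open import Data.List using (List; map; allFin)
open import Data.Nat.ListAction using (sum)
open import Data.Product using (Σ; ∃; _×_; _,_)
open import Data.Sum using (_⊎_)
open import Function.Definitions using (Injective)
open import Relation.Binary.PropositionalEquality using (_≡_; _≢_)
open import Relation.Nullary.Decidable using (⌊_⌋)

record Graph (N : ℕ) : Set where
  field
    adj     : Fin N → Fin N → Bool
    symm    : ∀ i j → adj i j ≡ adj j i
    irrefl  : ∀ i → adj i i ≡ false
open Graph public

edgeInd : ∀ {N} → Graph N → Fin N → Fin N → ℕ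
edgeInd G i j = if ⌊ toℕ i <? toℕ j ⌋ ∧ adj G i j then 1 else 0

e : ∀ {N} → Graph N → ℕ
e {N} G = sum (map (λ i → sum (map (λ j → edgeInd G i j) (allFin N))) (allFin N))

data Colour : Set where
  red blue : Colour

-- A red-blue colouring of the edges of G: a colour for each (unordered)
-- pair of vertices, i.e. a symmetric function; only its values on edges matter.
record Colouring {N : ℕ} (G : Graph N) : Set where
  field
    col  : Fin N → Fin N → Colour
    csym : ∀ i j → col i j ≡ col j i
open Colouring public

RedStar : ∀ {N} (k : ℕ) (G : Graph N) → Colouring G → Set
RedStar {N} k G c =
  Σ (Fin N) λ v → Σ (Fin k → Fin N) λ f →
    Injective _≡_ _≡_ f × (∀ i → adj G v (f i) ≡ true × col c v (f i) ≡ red)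

BlueClique : ∀ {N} (n : ℕ) (G : Graph N) → Colouring G → Set
BlueClique {N} n G c =
  Σ (Fin n → Fin N) λ f →
    Injective _≡_ _≡_ f ×
    (∀ i j → i ≢ j → adj G (f i) (f j) ≡ true × col c (f i) (f j) ≡ blue)

Arrows : ∀ {N} (k n : ℕ) → Graph N → Set
Arrows k n G = (c : Colouring G) → RedStar k G c ⊎ BlueClique n G c

-- m is the restricted size Ramsey number r̂*(K_{1,k}, K_n), where the
-- graphs F range over graphs on R vertices, R the Ramsey number
-- (instantiated below with R = r(K_{1,k},K_n) = k(n-1)+1):
-- m is the minimum of e(F) over F with |V(F)| = R and F ⟶ (K_{1,k},K_n).
IsRestrictedSizeRamsey : (R k n m : ℕ) → Set
IsRestrictedSizeRamsey R k n m =
  (Σ (Graph R) λ F → Arrows k n F × e F ≡ m) ×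
  ((F : Graph R) → Arrows k n F → m ≤ e F)

{-# OPTIONS --safe --termination-depth=2 #-}
module Submission where

-- Put R = k(n − 1) + 1. Upper bound on m: a complete graph on R vertices arrows (K₁ₖ, Kₙ) after
-- deleting a K_k or, for even k, a matching missing a single vertex, since a greedy search finds
-- an independent set of size n in the union of the deleted and the red edges. Lower bound on e G:
-- if the complement of G contained ℓ + 1 disjoint (k + 1)-sets without isolated vertices, then
-- these and k-sets would partition the vertices into n − 1 classes, and colouring the edges of G
-- red inside the classes and blue between them would avoid both a red K₁ₖ and a blue Kₙ. So the
-- complement has no such sets, and this bounds its number of edges by the number of deleted edges
-- plus C(R + ℓ, 2) − C(R, 2).

open import Defs
open import Data.Bool using (Bool; true; false; _∧_; _∨_; not; if_then_else_)
import Data.Bool.Properties as Bool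
open import Data.Empty using (⊥; ⊥-elim)
open import Data.Fin as Fin using (Fin; toℕ)
import Data.Fin.Properties as Fin
open import Data.List using (List; []; _∷_; _++_; map; length; allFin;
  concat; take; drop; lookup; tabulate)
open import Data.List.Properties using (length-++; length-tabulate; length-take; length-drop; take++drop≡id; ++-assoc; ++-identityʳ; concat-++; map-cong; map-∘; map-tabulate)
open import Data.List.Membership.Propositional using (_∈_; find)
open import Data.List.Membership.Propositional.Properties using (∈-∃++; ∈-concat⁻; ∈-allFin; ∈-lookup)
open import Data.List.Relation.Unary.All as All using (All; []; _∷_)
import Data.List.Relation.Unary.All.Properties as All
open import Data.List.Relation.Unary.AllPairs using (AllPairs; []; _∷_)
import Data.List.Relation.Unary.AllPairs.Properties as AllPairs
open import Data.List.Relation.Unary.Any as Any using (Any; here; there)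
import Data.List.Relation.Unary.Any.Properties as Any
open import Data.List.Relation.Binary.Permutation.Propositional using (_↭_; prep; swap; ↭-refl; ↭-sym; ↭-trans; ↭-reflexive)
import Data.List.Relation.Binary.Permutation.Propositional as Perm
import Data.List.Relation.Binary.Permutation.Setoid.Properties as Permₛ
open import Data.List.Relation.Binary.Permutation.Propositional.Properties using (∈-resp-↭; All-resp-↭; ↭-length; shift; ++⁺ˡ; ++⁺ʳ; ++-comm; shifts;
  map⁺)
open import Data.Nat using (ℕ; zero; suc; _+_; _*_; _∸_; _⊓_; _≤_; _<_; _<ᵇ_; _/_; z≤n; s≤s; _≤?_; _<?_; >-nonZero)
open import Data.Nat.DivMod using (m/n*n≤m)
open import Data.Nat.ListAction using (sum)
open import Data.Nat.ListAction.Properties using (sum-↭)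
open import Data.Nat.Properties
open import Data.Nat.Tactic.RingSolver using (solve-∀)
open import Data.Product using (∃; ∃₂; _×_; _,_; proj₁; proj₂)
open import Data.Sum using (_⊎_; inj₁; inj₂)
open import Function using (_∘_; id)
open import Relation.Binary.PropositionalEquality
open import Relation.Nullary using (yes; no; ¬_)
open import Relation.Nullary.Decidable using (⌊_⌋)

private variable
  A : Set
  N : ℕ

-- Counting along lists.

interchange : ∀ a b c d → a + b + (c + d) ≡ a + c + (b + d)
interchange = solve-∀

⟦_⟧ : Bool → ℕ
⟦ b ⟧ = if b then 1 else 0

⟦⟧≤1 : ∀ b → ⟦ b ⟧ ≤ 1
⟦⟧≤1 true = ≤-refl
⟦⟧≤1 false = z≤n

count : (A → Bool) → List A → ℕ
count p L = sum (map (λ x → ⟦ p x ⟧) L)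

count-↭ : ∀ (p : A → Bool) {L M} → L ↭ M → count p L ≡ count p M
count-↭ p σ = sum-↭ (map⁺ (λ x → ⟦ p x ⟧) σ)

count-++ : ∀ (p : A → Bool) L M → count p (L ++ M) ≡ count p L + count p M
count-++ p [] M = refl
count-++ p (x ∷ L) M = trans (cong (⟦ p x ⟧ +_) (count-++ p L M)) (sym (+-assoc ⟦ p x ⟧ _ _))

count≤length : ∀ (p : A → Bool) L → count p L ≤ length L
count≤length p [] = z≤n
count≤length p (x ∷ L) = +-mono-≤ (⟦⟧≤1 (p x)) (count≤length p L)

count-none : ∀ (p : A → Bool) L → (∀ {x} → x ∈ L → p x ≡ false) → count p L ≡ 0
count-none p [] h = refl
count-none p (x ∷ L) h rewrite h (here refl) = count-none p L (h ∘ there)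

count-mono : ∀ (p q : A → Bool) → (∀ x → ⟦ p x ⟧ ≤ ⟦ q x ⟧) → ∀ L → count p L ≤ count q L
count-mono p q h [] = z≤n
count-mono p q h (x ∷ L) = +-mono-≤ (h x) (count-mono p q h L)

count-cong : ∀ {p q : A → Bool} → (∀ x → p x ≡ q x) → ∀ L → count p L ≡ count q L
count-cong h L = cong sum (map-cong (λ x → cong ⟦_⟧ (h x)) L)

extract : ∀ (p : A → Bool) m L → m ≤ count p L →
  ∃₂ λ S T → L ↭ S ++ T × length S ≡ m × All (λ x → p x ≡ true) S
extract p zero L _ = [] , L , ↭-refl , refl , []
extract p (suc m) (x ∷ L) m≤ with p x in px
... | true with S , T , σ , |S| , ps ← extract p m L (≤-pred m≤) =
  x ∷ S , T , prep x σ , cong suc |S| , px ∷ ps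
... | false with S , T , σ , |S| , ps ← extract p (suc m) L m≤ =
  S , x ∷ T , ↭-trans (prep x σ) (↭-sym (shift x S T)) , |S| , ps

split : ∀ (p : A → Bool) L →
  ∃₂ λ S T → L ↭ S ++ T × length S ≡ count p L × All (λ x → p x ≡ false) T
split p [] = [] , [] , ↭-refl , refl , []
split p (x ∷ L) with p x in px | split p L
... | true  | S , T , σ , |S| , ps = x ∷ S , T , prep x σ , cong suc |S| , ps
... | false | S , T , σ , |S| , ps =
  S , x ∷ T , ↭-trans (prep x σ) (↭-sym (shift x S T)) , |S| , px ∷ ps

∃-true : ∀ (p : A → Bool) L → 1 ≤ count p L → ∃ λ x → x ∈ L × p x ≡ true
∃-true p (x ∷ L) h with p x in px
... | true = x , here refl , px
... | false with y , y∈ , py ← ∃-true p L h = y , there y∈ , py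

∃-false : ∀ (p : A → Bool) L → count p L < length L → ∃ λ x → x ∈ L × p x ≡ false
∃-false p (x ∷ L) h with p x in px
... | false = x , here refl , px
... | true with y , y∈ , py ← ∃-false p L (≤-pred h) = y , there y∈ , py

pull : ∀ {x : A} {L} → x ∈ L → ∃ λ M → L ↭ x ∷ M
pull {x = x} x∈ with ys , zs , refl ← ∈-∃++ x∈ = ys ++ zs , shift x ys zs

-- All images lie in the part of L where p holds, and their positions there form an injection into a
-- finite set of size `count p L`.
injection⇒count : ∀ {k} (p : A → Bool) L (f : Fin k → A) → (∀ {i j} → f i ≡ f j → i ≡ j) →
  (∀ i → f i ∈ L) → (∀ i → p (f i) ≡ true) → k ≤ count p L
injection⇒count p L f inj f∈ pf
  with S , T , σ , |S| , ps ← split p L =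
  subst (_ ≤_) |S| (Fin.injective⇒≤ {f = λ i → Any.index (f∈S i)} λ {i} {j} eq →
    inj (trans (Any.lookup-index (f∈S i)) (trans (cong (lookup S) eq) (sym (Any.lookup-index (f∈S j))))))
  where
  f∈S : ∀ i → f i ∈ S
  f∈S i with Any.++⁻ S (∈-resp-↭ σ (f∈ i))
  ... | inj₁ q = q
  ... | inj₂ q with () ← trans (sym (pf i)) (All.lookup ps q)

-- Degrees and edge counts over lists of vertices.

deg : Graph N → Fin N → List (Fin N) → ℕ
deg G v = count (adj G v)

-- Each vertex counts its neighbours later in the list, so every pair of positions is met once.
-- Taking a list as argument lets one function measure all induced subgraphs.
edges : Graph N → List (Fin N) → ℕ
edges G [] = 0
edges G (v ∷ L) = deg G v L + edges G L

edges-↭ : ∀ (G : Graph N) {L M} → L ↭ M → edges G L ≡ edges G M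
edges-↭ G Perm.refl = refl
edges-↭ G (prep x σ) = cong₂ _+_ (count-↭ (adj G x) σ) (edges-↭ G σ)
edges-↭ G (swap {xs} {ys} x y σ) rewrite symm G x y | count-↭ (adj G x) σ | count-↭ (adj G y) σ | edges-↭ G σ =
  interchange ⟦ adj G y x ⟧ (deg G x ys) (deg G y ys) (edges G ys)
edges-↭ G (Perm.trans σ τ) = trans (edges-↭ G σ) (edges-↭ G τ)

deg-self : ∀ (G : Graph N) v L → deg G v (v ∷ L) ≡ deg G v L
deg-self G v L rewrite irrefl G v = refl

sum-map-+ : ∀ (f g : A → ℕ) L → sum (map (λ x → f x + g x) L) ≡ sum (map f L) + sum (map g L)
sum-map-+ f g [] = refl
sum-map-+ f g (x ∷ L) = trans (cong (f x + g x +_) (sum-map-+ f g L)) (interchange (f x) (g x) _ _)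

handshake : ∀ (G : Graph N) L → sum (map (λ v → deg G v L) L) ≡ 2 * edges G L
handshake G [] = refl
handshake G (v ∷ L) = begin
  deg G v (v ∷ L) + sum (map (λ u → ⟦ adj G u v ⟧ + deg G u L) L)
    ≡⟨ cong₂ _+_ (deg-self G v L) (sum-map-+ (λ u → ⟦ adj G u v ⟧) (λ u → deg G u L) L) ⟩
  deg G v L + (count (λ u → adj G u v) L + sum (map (λ u → deg G u L) L))
    ≡⟨ cong₂ (λ a b → deg G v L + (a + b)) (count-cong (λ u → symm G u v) L) (handshake G L) ⟩
  deg G v L + (deg G v L + 2 * edges G L)
    ≡⟨ double (deg G v L) (edges G L) ⟩
  2 * (deg G v L + edges G L) ∎
  where
  open ≡-Reasoning
  double : ∀ a b → a + (a + 2 * b) ≡ 2 * (a + b)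
  double = solve-∀

sum-map-const : ∀ (f : A → ℕ) c L → (∀ {x} → x ∈ L → f x ≡ c) → sum (map f L) ≡ length L * c
sum-map-const f c [] h = refl
sum-map-const f c (x ∷ L) h = cong₂ _+_ (h (here refl)) (sum-map-const f c L (h ∘ there))

sum-map-≤ : ∀ (f : A → ℕ) c L → (∀ {x} → x ∈ L → f x ≤ c) → sum (map f L) ≤ length L * c
sum-map-≤ f c [] h = z≤n
sum-map-≤ f c (x ∷ L) h = +-mono-≤ (h (here refl)) (sum-map-≤ f c L (h ∘ there))

-- The binomial coefficient C(n, 2), by the same recursion as `edges`.
pairs : ℕ → ℕ
pairs zero = 0
pairs (suc n) = n + pairs n

pairs-mono : ∀ {m n} → m ≤ n → pairs m ≤ pairs n
pairs-mono z≤n = z≤n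
pairs-mono (s≤s m≤n) = +-mono-≤ m≤n (pairs-mono m≤n)

edges≤pairs : ∀ (G : Graph N) L → edges G L ≤ pairs (length L)
edges≤pairs G [] = z≤n
edges≤pairs G (v ∷ L) = +-mono-≤ (count≤length (adj G v) L) (edges≤pairs G L)

-- Complements, and agreement of the two edge counts.

complement : Graph N → Graph N
complement G .adj u v = not (adj G u v) ∧ not ⌊ u Fin.≟ v ⌋
complement G .symm u v with u Fin.≟ v | v Fin.≟ u
... | yes _ | yes _ = cong (λ b → not b ∧ false) (symm G u v)
... | no _ | no _ = cong (λ b → not b ∧ true) (symm G u v)
... | yes refl | no v≢u = ⊥-elim (v≢u refl)
... | no u≢v | yes refl = ⊥-elim (u≢v refl)
complement G .irrefl u with u Fin.≟ u
... | yes _ = Bool.∧-zeroʳ _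
... | no u≢u = ⊥-elim (u≢u refl)

adj-complement : ∀ (G : Graph N) {u v} → u ≢ v → adj (complement G) u v ≡ not (adj G u v)
adj-complement G {u} {v} u≢v with u Fin.≟ v
... | yes u≡v = ⊥-elim (u≢v u≡v)
... | no _ = Bool.∧-identityʳ _

complement⇒nonadj : ∀ (G : Graph N) {u v} → adj (complement G) u v ≡ true → adj G u v ≡ false
complement⇒nonadj G {u} {v} uv with adj G u v
... | false = refl

complement-involutive : ∀ (G : Graph N) u v → adj (complement (complement G)) u v ≡ adj G u v
complement-involutive G u v with u Fin.≟ v
... | yes refl = trans (Bool.∧-zeroʳ _) (sym (irrefl G u))
... | no _ = trans (Bool.∧-identityʳ _) (trans (cong not (Bool.∧-identityʳ _)) (Bool.not-involutive _))

deg-complement : ∀ (G : Graph N) v L → All (v ≢_) L → deg G v L + deg (complement G) v L ≡ length L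
deg-complement G v [] [] = refl
deg-complement G v (u ∷ L) (v≢u ∷ h) rewrite adj-complement G v≢u | sym (deg-complement G v L h)
  with adj G v u
... | true = refl
... | false = +-suc _ _

edges-complement : ∀ (G : Graph N) {L} → AllPairs _≢_ L → edges G L + edges (complement G) L ≡ pairs (length L)
edges-complement G [] = refl
edges-complement G {v ∷ L} (h ∷ hs) = trans (interchange (deg G v L) _ _ _)
  (cong₂ _+_ (deg-complement G v L h) (edges-complement G hs))

edgeInd-< : ∀ (G : Graph N) {i j} → i Fin.< j → edgeInd G i j ≡ ⟦ adj G i j ⟧
edgeInd-< G {i} {j} i<j with toℕ i <? toℕ j
... | yes _ = refl
... | no i≮j = ⊥-elim (i≮j i<j)

edgeInd-≥ : ∀ (G : Graph N) {i j} → ¬ (i Fin.< j) → edgeInd G i j ≡ 0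
edgeInd-≥ G {i} {j} i≮j with toℕ i <? toℕ j
... | yes i<j = ⊥-elim (i≮j i<j)
... | no _ = refl

-- In an increasing list the row of the head is its degree into the tail, while its column vanishes
-- because all later vertices are larger.
edges-sorted : ∀ (G : Graph N) {L} → AllPairs Fin._<_ L →
  sum (map (λ i → sum (map (edgeInd G i) L)) L) ≡ edges G L
edges-sorted G [] = refl
edges-sorted G {v ∷ L} (v< ∷ s) = begin
  edgeInd G v v + sum (map (edgeInd G v) L) + sum (map (λ i → edgeInd G i v + sum (map (edgeInd G i) L)) L)
    ≡⟨ cong₂ _+_ (cong₂ _+_ (edgeInd-≥ G (<-irrefl refl)) (row L v<))
         (trans (sum-map-+ (λ i → edgeInd G i v) _ L) (cong₂ _+_ (column L v<) (edges-sorted G s))) ⟩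
  deg G v L + edges G L ∎
  where
  open ≡-Reasoning
  row : ∀ M → All (v Fin.<_) M → sum (map (edgeInd G v) M) ≡ deg G v M
  row [] [] = refl
  row (u ∷ M) (v<u ∷ h) = cong₂ _+_ (edgeInd-< G v<u) (row M h)
  column : ∀ M → All (v Fin.<_) M → sum (map (λ i → edgeInd G i v) M) ≡ 0
  column [] [] = refl
  column (u ∷ M) (v<u ∷ h) = cong₂ _+_ (edgeInd-≥ G (<-asym v<u)) (column M h)

e≡edges : ∀ (G : Graph N) → e G ≡ edges G (allFin N)
e≡edges G = edges-sorted G (AllPairs.tabulate⁺-< id)

length-allFin : ∀ n → length (allFin n) ≡ n
length-allFin n = length-tabulate id

e+edges-complement : ∀ (G : Graph N) → e G + edges (complement G) (allFin N) ≡ pairs N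
e+edges-complement {N} G rewrite e≡edges G =
  trans (edges-complement G (AllPairs.tabulate⁺ id)) (cong pairs (length-allFin N))

-- Growing sets without isolated vertices.

NoIsolated : Graph N → List (Fin N) → Set
NoIsolated G S = ∀ {v} → v ∈ S → ∃ λ u → u ∈ S × adj G v u ≡ true

noIsolated-++ : ∀ (G : Graph N) S T → NoIsolated G S → NoIsolated G T → NoIsolated G (S ++ T)
noIsolated-++ G S T hS hT v∈ with Any.++⁻ S v∈
... | inj₁ v∈S with u , u∈ , uv ← hS v∈S = u , Any.++⁺ˡ u∈ , uv
... | inj₂ v∈T with u , u∈ , uv ← hT v∈T = u , Any.++⁺ʳ S u∈ , uv

noIsolated-↭ : ∀ (G : Graph N) {S T} → S ↭ T → NoIsolated G S → NoIsolated G T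
noIsolated-↭ G σ h v∈ with u , u∈ , uv ← h (∈-resp-↭ (↭-sym σ) v∈) = u , ∈-resp-↭ σ u∈ , uv

noIsolated-∷ : ∀ (G : Graph N) {v u S} → u ∈ S → adj G v u ≡ true → NoIsolated G S → NoIsolated G (v ∷ S)
noIsolated-∷ G u∈ vu h (here refl) = _ , there u∈ , vu
noIsolated-∷ G u∈ vu h (there w∈) with u , u∈ , uv ← h w∈ = u , there u∈ , uv

noIsolated-star : ∀ (G : Graph N) v {L} → 1 ≤ length L → All (λ u → adj G v u ≡ true) L → NoIsolated G (v ∷ L)
noIsolated-star G v (s≤s _) (vu ∷ _) (here refl) = _ , there (here refl) , vu
noIsolated-star G v _ h (there w∈) = v , here refl , trans (symm G _ v) (All.lookup h w∈)

noIsolated-edge : ∀ (G : Graph N) {u v} → adj G u v ≡ true → NoIsolated G (u ∷ v ∷ [])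
noIsolated-edge G uv = noIsolated-star G _ (s≤s z≤n) (uv ∷ [])

Block : Graph N → ℕ → List (Fin N) → Set
Block G b W = ∃₂ λ S T → W ↭ S ++ T × length S ≡ b × NoIsolated G S

data Frontier (G : Graph N) (S T : List (Fin N)) : Set where
  outside : ∀ {u v T′} → T ↭ u ∷ v ∷ T′ → adj G u v ≡ true → Frontier G S T
  touching : ∀ {u v T′} → T ↭ v ∷ T′ → u ∈ S → adj G v u ≡ true → Frontier G S T

-- T is scanned vertex by vertex: a vertex with no neighbour in S or later in T contributes no edge
-- and is passed over, and the surplus of edges prevents T from being exhausted.
frontier : ∀ (G : Graph N) S T → edges G S < edges G (S ++ T) → Frontier G S T
frontier G S T lt = go T (subst (edges G S <_) (edges-↭ G (++-comm S T)) lt)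
  where
  go : ∀ T → edges G S < edges G (T ++ S) → Frontier G S T
  go [] lt = ⊥-elim (<-irrefl refl lt)
  go (v ∷ T) lt with 1 ≤? deg G v T | 1 ≤? deg G v S
  ... | yes d | _ with u , u∈ , vu ← ∃-true (adj G v) T d with T′ , σ ← pull u∈ = outside (prep v σ) vu
  ... | no _ | yes d with u , u∈ , vu ← ∃-true (adj G v) S d = touching ↭-refl u∈ vu
  ... | no d | no d′ with go T lt′
    where
    lt′ : edges G S < edges G (T ++ S)
    lt′ = subst (λ c → edges G S < c + edges G (T ++ S))
      (trans (count-++ (adj G v) T S) (cong₂ _+_ (n<1⇒n≡0 (≰⇒> d)) (n<1⇒n≡0 (≰⇒> d′)))) lt
  ... | outside σ uv = outside (↭-trans (prep v σ) (Perm.trans (swap v _ ↭-refl) (prep _ (swap v _ ↭-refl)))) uv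
  ... | touching σ u∈ vu = touching (↭-trans (prep v σ) (swap v _ ↭-refl)) u∈ vu

frontier-small : ∀ (G : Graph N) {b W} S T → W ↭ S ++ T → length S ≤ b → pairs b < edges G W → Frontier G S T
frontier-small G S T σ |S|≤b big = frontier G S T
  (≤-<-trans (edges≤pairs G S) (≤-<-trans (pairs-mono |S|≤b) (subst (_ <_) (edges-↭ G σ) big)))

-- Adding a whole edge may overshoot the target size by one; dropping x repairs this.
grow-removable : ∀ (G : Graph N) k {W} → pairs k < edges G W →
  ∀ f x S T → W ↭ x ∷ S ++ T → NoIsolated G (x ∷ S) → NoIsolated G S → length S + f ≡ suc k → Block G (suc k) W
-- The number f counts the vertices missing from S without x: at 0 the vertex x is dropped, at 1 it
-- is kept.
grow-removable G k big zero x S T σ _ hS size =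
  S , x ∷ T , ↭-trans σ (↭-sym (shift x S T)) , trans (sym (+-identityʳ _)) size , hS
grow-removable G k big (suc zero) x S T σ hxS _ size =
  x ∷ S , T , σ , trans (+-comm 1 (length S)) size , hxS
grow-removable G k big (suc (suc f)) x S T σ hxS hS size
  with frontier-small G (x ∷ S) T σ |xS|≤k big
  where
  |xS|≤k : suc (length S) ≤ k
  |xS|≤k = ≤-pred (≤-trans (≤-trans (≤-reflexive (+-comm 2 (length S))) (+-monoʳ-≤ (length S) (s≤s (s≤s z≤n))))
    (≤-reflexive size))
... | outside {u} {v} {T′} τ uv = grow-removable G k big f x (u ∷ v ∷ S) T′
  (↭-trans σ (prep x (↭-trans (++⁺ˡ S τ) (↭-trans (shift u S _) (prep u (shift v S T′))))))
  (noIsolated-↭ G (↭-trans (prep u (swap v x ↭-refl)) (swap u x ↭-refl))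
    (noIsolated-++ G (u ∷ v ∷ []) (x ∷ S) (noIsolated-edge G uv) hxS))
  (noIsolated-++ G (u ∷ v ∷ []) S (noIsolated-edge G uv) hS)
  (trans (sym (trans (+-suc (length S) (suc f)) (cong suc (+-suc (length S) f)))) size)
-- A vertex joined to x might become isolated once x is dropped, so x joins S and v becomes the
-- removable vertex.
... | touching {v = v} {T′} τ (here refl) vx = grow-removable G k big (suc f) v (x ∷ S) T′
  (↭-trans σ (↭-trans (prep x (++⁺ˡ S τ)) (shift v (x ∷ S) T′)))
  (noIsolated-∷ G (here refl) vx hxS) hxS
  (trans (sym (+-suc (length S) (suc f))) size)
... | touching {v = v} {T′} τ (there u∈S) vu = grow-removable G k big (suc f) x (v ∷ S) T′
  (↭-trans σ (prep x (↭-trans (++⁺ˡ S τ) (shift v S T′))))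
  (noIsolated-↭ G (swap v x ↭-refl) (noIsolated-∷ G (there u∈S) vu hxS))
  (noIsolated-∷ G u∈S vu hS)
  (trans (sym (+-suc (length S) (suc f))) size)

-- An even number of vertices is missing, so adding whole edges never overshoots. The first single
-- vertex attached to S is removable, since S has no isolated vertex without it.
grow-even : ∀ (G : Graph N) k {W} → pairs k < edges G W →
  ∀ f S T → W ↭ S ++ T → NoIsolated G S → length S + f * 2 ≡ suc k → Block G (suc k) W
grow-even G k big zero S T σ hS size = S , T , σ , trans (sym (+-identityʳ _)) size , hS
grow-even G k big (suc f) S T σ hS size
  with frontier-small G S T σ |S|≤k big
  where
  |S|≤k : length S ≤ k
  |S|≤k = ≤-pred (≤-trans (≤-trans (≤-reflexive (+-comm 1 (length S))) (+-monoʳ-≤ (length S) (s≤s z≤n)))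
    (≤-reflexive size))
... | outside {u} {v} {T′} τ uv = grow-even G k big f (u ∷ v ∷ S) T′
  (↭-trans σ (↭-trans (++⁺ˡ S τ) (↭-trans (shift u S _) (prep u (shift v S T′)))))
  (noIsolated-++ G (u ∷ v ∷ []) S (noIsolated-edge G uv) hS)
  (trans (sym (trans (+-suc (length S) (suc (f * 2))) (cong suc (+-suc (length S) (f * 2))))) size)
... | touching {v = v} {T′} τ u∈S vu = grow-removable G k big (suc f * 2) v S T′
  (↭-trans σ (↭-trans (++⁺ˡ S τ) (shift v S T′)))
  (noIsolated-∷ G u∈S vu hS) hS size

block-odd : ∀ (G : Graph N) k j {W} → k ≡ suc (j * 2) → pairs k < edges G W → Block G (suc k) W
block-odd G k j {W} k≡ big = grow-even G k big (suc j) [] W ↭-refl (λ ()) (cong suc (sym k≡))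

-- A matching has no set of odd size without isolated vertices, so for even k more edges than a
-- matching can have are demanded. They force a vertex v with two neighbours a and b, and in the
-- path a v b the end b is removable.
block-path : ∀ (G : Graph N) k {W} → 2 ≤ k → length W < 2 * edges G W → pairs k < edges G W → Block G (suc k) W
block-path G k@(suc (suc k₀)) {W} (s≤s (s≤s z≤n)) dense big with Any.any? (λ v → 2 ≤? deg G v W) W
... | no low = ⊥-elim (<⇒≱ dense (subst (_≤ length W) (handshake G W)
  (≤-trans (sum-map-≤ _ 1 W λ v∈ → ≤-pred (≰⇒> (All.lookup (All.¬Any⇒All¬ W low) v∈)))
    (≤-reflexive (*-identityʳ _)))))
... | yes high
  with v , v∈ , 2≤d ← find high
  with W′ , σ ← pull v∈
  with a ∷ b ∷ [] , T , τ , refl , va ∷ vb ∷ [] ←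
    extract (adj G v) 2 W′ (≤-trans 2≤d (≤-reflexive (trans (count-↭ (adj G v) σ) (deg-self G v W′)))) =
  grow-removable G k big (suc k₀) b (v ∷ a ∷ []) T
    (↭-trans σ (↭-trans (prep v τ) (↭-trans (prep v (swap a b ↭-refl)) (swap v b ↭-refl))))
    (noIsolated-∷ G (here refl) (trans (symm G b v) vb) (noIsolated-edge G va))
    (noIsolated-edge G va) refl

-- Packing disjoint blocks.

edges-++-≤ : ∀ (G : Graph N) Δ S T → (∀ {v} → v ∈ S → deg G v (S ++ T) ≤ Δ) →
  edges G (S ++ T) ≤ length S * Δ + edges G T
edges-++-≤ G Δ [] T h = ≤-refl
edges-++-≤ G Δ (v ∷ S) T h = begin
  deg G v (S ++ T) + edges G (S ++ T)
    ≤⟨ +-mono-≤ (m+n≤o⇒n≤o ⟦ adj G v v ⟧ (h (here refl)))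
         (edges-++-≤ G Δ S T λ {u} u∈ → m+n≤o⇒n≤o ⟦ adj G u v ⟧ (h (there u∈))) ⟩
  Δ + (length S * Δ + edges G T) ≡⟨ +-assoc Δ _ _ ⟨
  Δ + length S * Δ + edges G T ∎
  where open ≤-Reasoning

length-concat : ∀ b (Ls : List (List A)) → All (λ S → length S ≡ b) Ls → length (concat Ls) ≡ length Ls * b
length-concat b [] [] = refl
length-concat b (S ∷ Ls) (|S| ∷ h) = trans (length-++ S) (cong₂ _+_ |S| (length-concat b Ls h))

Packing : Graph N → ℕ → ℕ → List (Fin N) → Set
Packing G b r W = ∃₂ λ Ls T → W ↭ concat Ls ++ T × length Ls ≡ r × All (λ S → length S ≡ b × NoIsolated G S) Ls

-- pairs (q + R) ∸ pairs R is the Erdős–Gallai bound for matchings of size q. A vertex of degree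
-- above Δ can be set aside: it completes to a star avoiding any ℓ blocks found without it.
pack : ∀ (G : Graph N) k₀ ℓ R B → let k = suc k₀; Δ = ℓ * suc k + k₀ in suc k * Δ ≤ R →
  (∀ q W → length W ≤ q + R → pairs (q + R) + B < edges G W + pairs R → Block G (suc k) W) →
  ∀ q W → q ≤ ℓ → length W ≤ q + R → pairs (q + R) + B < edges G W + pairs R → Packing G (suc k) (suc q) W
pack {N} G k₀ ℓ R B ΔR block = go
  where
  k Δ : ℕ
  k = suc k₀
  Δ = ℓ * suc k + k₀

  -- Going from q + 1 to q lowers the threshold by exactly q + R, so a step may lose that many
  -- edges.
  budget : ∀ q c m → c ≤ q + R → pairs (suc q + R) + B < c + m + pairs R → pairs (q + R) + B < m + pairs R
  budget q c m c≤ lt = +-cancelˡ-< (q + R) _ _ (begin-strict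
    q + R + (pairs (q + R) + B) ≡⟨ +-assoc (q + R) _ _ ⟨
    pairs (suc q + R) + B <⟨ lt ⟩
    c + m + pairs R ≡⟨ +-assoc c m _ ⟩
    c + (m + pairs R) ≤⟨ +-monoˡ-≤ _ c≤ ⟩
    q + R + (m + pairs R) ∎)
    where open ≤-Reasoning

  module VertexStep {q : ℕ} {W W′ : List (Fin N)} {v : Fin N} (σ : W ↭ v ∷ W′) (q<ℓ : suc q ≤ ℓ) where
    small : length W ≤ suc q + R → length W′ ≤ q + R
    small h = ≤-pred (subst (_≤ suc q + R) (↭-length σ) h)

    big : length W ≤ suc q + R → pairs (suc q + R) + B < edges G W + pairs R → pairs (q + R) + B < edges G W′ + pairs R
    big h lt = budget q (deg G v W′) _ (≤-trans (count≤length (adj G v) W′) (small h))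
      (subst (λ m → _ < m + pairs R) (edges-↭ G σ) lt)

    -- The q + 1 ≤ ℓ blocks cover at most ℓ(k + 1) vertices, and Δ + 1 = ℓ(k + 1) + k, so k
    -- neighbours of v lie outside them.
    star : ∀ Ls {T} → W′ ↭ concat Ls ++ T → length Ls ≡ suc q → All (λ S → length S ≡ suc k × NoIsolated G S) Ls →
      suc Δ ≤ deg G v W → k ≤ deg G v T
    star Ls {T} τ |Ls| hLs Δ<d = +-cancelˡ-≤ (suc q * suc k) _ _ (begin
      suc q * suc k + k ≤⟨ +-monoˡ-≤ k (*-monoˡ-≤ (suc k) q<ℓ) ⟩
      ℓ * suc k + k ≡⟨ +-suc _ k₀ ⟩
      suc Δ ≤⟨ Δ<d ⟩
      deg G v W ≡⟨ trans (count-↭ (adj G v) σ) (deg-self G v W′) ⟩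
      deg G v W′ ≡⟨ trans (count-↭ (adj G v) τ) (count-++ (adj G v) (concat Ls) T) ⟩
      deg G v (concat Ls) + deg G v T
        ≤⟨ +-monoˡ-≤ _ (≤-trans (count≤length (adj G v) (concat Ls))
             (≤-reflexive (trans (length-concat (suc k) Ls (All.map proj₁ hLs)) (cong (_* suc k) |Ls|)))) ⟩
      suc q * suc k + deg G v T ∎)
      where open ≤-Reasoning

  module BlockStep (q : ℕ) {W : List (Fin N)} (S : List (Fin N)) {W′ : List (Fin N)} (σ : W ↭ S ++ W′) (|S| : length S ≡ suc k) where
    small : length W ≤ suc q + R → length W′ ≤ q + R
    small h = ≤-pred (begin
      suc (length W′) ≤⟨ s≤s (m≤n+m _ k) ⟩
      suc k + length W′ ≡⟨ cong (_+ length W′) |S| ⟨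
      length S + length W′ ≡⟨ length-++ S ⟨
      length (S ++ W′) ≡⟨ ↭-length σ ⟨
      length W ≤⟨ h ⟩
      suc q + R ∎)
      where open ≤-Reasoning

    big : ¬ Any (λ v → suc Δ ≤ deg G v W) W → pairs (suc q + R) + B < edges G W + pairs R →
      pairs (q + R) + B < edges G W′ + pairs R
    big low lt = budget q (suc k * Δ) _ (≤-trans ΔR (m≤n+m R q)) (<-≤-trans lt (+-monoˡ-≤ (pairs R) (begin
      edges G W ≡⟨ edges-↭ G σ ⟩
      edges G (S ++ W′) ≤⟨ edges-++-≤ G Δ S W′ lowDeg ⟩
      length S * Δ + edges G W′ ≡⟨ cong (λ s → s * Δ + edges G W′) |S| ⟩
      suc k * Δ + edges G W′ ∎)))
      where
      open ≤-Reasoning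
      lowDeg : ∀ {v} → v ∈ S → deg G v (S ++ W′) ≤ Δ
      lowDeg {v} v∈ = ≤-pred (≰⇒> λ d → All.lookup (All.¬Any⇒All¬ W low)
        (∈-resp-↭ (↭-sym σ) (Any.++⁺ˡ v∈)) (subst (suc Δ ≤_) (sym (count-↭ (adj G v) σ)) d))

  go : ∀ q W → q ≤ ℓ → length W ≤ q + R → pairs (q + R) + B < edges G W + pairs R → Packing G (suc k) (suc q) W
  go zero W q≤ small big with S , T , σ , |S| , hS ← block zero W small big =
    S ∷ [] , T , ↭-trans σ (↭-reflexive (cong (_++ T) (sym (++-identityʳ S)))) , refl , (|S| , hS) ∷ []
  go (suc q) W q<ℓ small big with Any.any? (λ v → suc Δ ≤? deg G v W) W
  ... | yes high
    with v , v∈ , Δ<d ← find high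
    with W′ , σ ← pull v∈
    with Ls , T , τ , |Ls| , hLs ← go q W′ (<⇒≤ q<ℓ) (VertexStep.small σ q<ℓ small) (VertexStep.big σ q<ℓ small big)
    with S , T′ , ρ , |S| , vS ← extract (adj G v) k T (VertexStep.star σ q<ℓ Ls τ |Ls| hLs Δ<d)
    = (v ∷ S) ∷ Ls , T′
    , ↭-trans σ (prep v (↭-trans τ (↭-trans (++⁺ˡ (concat Ls) ρ)
        (↭-trans (shifts (concat Ls) S) (↭-reflexive (sym (++-assoc S (concat Ls) T′)))))))
    , cong suc |Ls|
    , (cong suc |S| , noIsolated-star G v (subst (1 ≤_) (sym |S|) (s≤s z≤n)) vS) ∷ hLs
  -- All degrees are now at most Δ, so deleting a block loses at most (k + 1)Δ ≤ R edges, which is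
  -- within the budget.
  ... | no low
    with S , W′ , σ , |S| , hS ← block (suc q) W small big
    with Ls , T , τ , |Ls| , hLs ← go q W′ (<⇒≤ q<ℓ) (BlockStep.small q S σ |S| small) (BlockStep.big q S σ |S| low big)
    = S ∷ Ls , T
    , ↭-trans σ (↭-trans (++⁺ˡ S τ) (↭-reflexive (sym (++-assoc S (concat Ls) T))))
    , cong suc |Ls| , (|S| , hS) ∷ hLs

-- Partition colourings without red stars and blue cliques.

chop : ∀ k p (T : List A) → length T ≤ p * k → ∃ λ Ls → length Ls ≡ p × concat Ls ≡ T × All (λ S → length S ≤ k) Ls
chop k zero [] z≤n = [] , refl , refl , []
chop k (suc p) T h
  with Ls , |Ls| , eq , hLs ← chop k p (drop k T)
    (subst (_≤ p * k) (sym (length-drop k T)) (m≤n+o⇒m∸n≤o (length T) k h)) =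
  take k T ∷ Ls , cong suc |Ls| , trans (cong (take k T ++_) eq) (take++drop≡id k T)
  , subst (_≤ k) (sym (length-take k T)) (m⊓n≤m k (length T)) ∷ hLs

deg-short : ∀ (G : Graph N) {k v S} → length S ≤ k → v ∈ S → deg G v S < k
deg-short G {k} {v} {S} |S|≤k v∈ with T , σ ← pull v∈
  rewrite count-↭ (adj G v) σ | ↭-length σ | deg-self G v T = ≤-trans (s≤s (count≤length (adj G v) T)) |S|≤k

-- Among the k + 1 vertices of S, v is adjacent neither to itself nor to its neighbour in the
-- complement, which leaves k - 1.
deg-block : ∀ (G : Graph N) {k v S} → length S ≡ suc k → NoIsolated (complement G) S → v ∈ S → deg G v S < k
deg-block G {k} {v} {S} |S| h v∈
  with u , u∈ , vu ← h v∈
  with T , σ ← pull v∈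
  with ∈-resp-↭ σ u∈
... | here refl with () ← trans (sym vu) (irrefl (complement G) v)
... | there u∈T
  with T′ , τ ← pull u∈T
  rewrite count-↭ (adj G v) σ | deg-self G v T | count-↭ (adj G v) τ | complement⇒nonadj G vu
    | suc-injective (trans (sym |S|) (trans (↭-length σ) (cong suc (↭-length τ)))) =
  s≤s (count≤length (adj G v) T′)

-- A red star stays inside the class of its centre, where degrees are below k; a blue clique meets
-- each class at most once. The function `class` reads one class per vertex off `cover`, so
-- overlapping classes do no harm.
¬arrows : ∀ (G : Graph N) k n (Ls : List (List (Fin N))) → length Ls < n → (∀ v → Any (v ∈_) Ls) →
  All (λ S → ∀ v → v ∈ S → deg G v S < k) Ls → ¬ Arrows k n G
¬arrows {N} G k n Ls few cover hLs arrows = contra (arrows colouring)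
  where
  class : Fin N → Fin (length Ls)
  class v = Any.index (cover v)

  colouring : Colouring G
  colouring .col u v = if ⌊ class u Fin.≟ class v ⌋ then red else blue
  colouring .csym u v with class u Fin.≟ class v | class v Fin.≟ class u
  ... | yes _ | yes _ = refl
  ... | no _ | no _ = refl
  ... | yes p | no q = ⊥-elim (q (sym p))
  ... | no p | yes q = ⊥-elim (p (sym q))

  red⇒≡ : ∀ u v → col colouring u v ≡ red → class u ≡ class v
  red⇒≡ u v eq with yes p ← class u Fin.≟ class v = p

  blue⇒≢ : ∀ u v → col colouring u v ≡ blue → class u ≢ class v
  blue⇒≢ u v eq with no p ← class u Fin.≟ class v = p

  ∈-class : ∀ v → v ∈ lookup Ls (class v)
  ∈-class v = Any.lookup-index (cover v)

  contra : RedStar k G colouring ⊎ BlueClique n G colouring → ⊥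
  contra (inj₁ (v , f , inj , star)) = <⇒≱ (All.lookup hLs (∈-lookup (class v)) v (∈-class v))
    (injection⇒count (adj G v) (lookup Ls (class v)) f inj
      (λ i → subst (λ c → f i ∈ lookup Ls c) (sym (red⇒≡ v (f i) (proj₂ (star i)))) (∈-class (f i)))
      (proj₁ ∘ star))
  contra (inj₂ (f , inj , clique)) with i , j , i<j , eq ← Fin.pigeonhole few (class ∘ f) =
    blue⇒≢ (f i) (f j) (proj₂ (clique i j (Fin.<⇒≢ i<j))) eq

-- Arrowing from independent sets.

≢-resp-↭ : ∀ {L M : List A} → L ↭ M → AllPairs _≢_ L → AllPairs _≢_ M
≢-resp-↭ {A} σ = Permₛ.Unique-resp-↭ (setoid A) (Perm.↭⇒↭ₛ σ)

allPairs-++⁻ˡ : ∀ {R : A → A → Set} L {M} → AllPairs R (L ++ M) → AllPairs R L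
allPairs-++⁻ˡ [] _ = []
allPairs-++⁻ˡ (x ∷ L) (h ∷ hs) = All.++⁻ˡ L h ∷ allPairs-++⁻ˡ L hs

allPairs-++⁻ʳ : ∀ {R : A → A → Set} L {M} → AllPairs R (L ++ M) → AllPairs R M
allPairs-++⁻ʳ [] h = h
allPairs-++⁻ʳ (x ∷ L) (_ ∷ hs) = allPairs-++⁻ʳ L hs

allPairs-lookup : ∀ {R : A → A → Set} → (∀ {x y} → R x y → R y x) → ∀ {L} → AllPairs R L →
  ∀ {i j} → i ≢ j → R (lookup L i) (lookup L j)
allPairs-lookup R-sym (h ∷ hs) {Fin.zero} {Fin.zero} i≢j = ⊥-elim (i≢j refl)
allPairs-lookup R-sym {x ∷ L} (h ∷ hs) {Fin.zero} {Fin.suc j} _ = All.lookup h (∈-lookup j)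
allPairs-lookup R-sym {x ∷ L} (h ∷ hs) {Fin.suc i} {Fin.zero} _ = R-sym (All.lookup h (∈-lookup i))
allPairs-lookup R-sym (h ∷ hs) {Fin.suc i} {Fin.suc j} i≢j = allPairs-lookup R-sym hs (i≢j ∘ cong Fin.suc)

-- Turns a list into the injective families that `RedStar` and `BlueClique` ask for; injectivity
-- comes from the irreflexivity of R.
enumerate : ∀ {R : A → A → Set} {m} L → length L ≡ m → (∀ {x y} → R x y → R y x) → (∀ {x} → ¬ R x x) → AllPairs R L →
  ∃ λ (f : Fin m → A) → (∀ {i j} → f i ≡ f j → i ≡ j) × (∀ i j → i ≢ j → R (f i) (f j)) × (∀ i → f i ∈ L)
enumerate {R = R} L refl R-sym R-irr h = lookup L , inj , (λ i j → allPairs-lookup R-sym h) , ∈-lookup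
  where
  inj : ∀ {i j} → lookup L i ≡ lookup L j → i ≡ j
  inj {i} {j} eq with i Fin.≟ j
  ... | yes i≡j = i≡j
  ... | no i≢j = ⊥-elim (R-irr (subst (R _) (sym eq) (allPairs-lookup R-sym h i≢j)))

-- Distinctness is included because no vertex is adjacent to itself: a pairwise `NonAdj` list is
-- then free of repetitions.
NonAdj : Graph N → Fin N → Fin N → Set
NonAdj H u v = u ≢ v × adj H u v ≡ false

nonAdj-sym : ∀ (H : Graph N) {u v} → NonAdj H u v → NonAdj H v u
nonAdj-sym H (u≢v , uv) = u≢v ∘ sym , trans (symm H _ _) uv

HasIndependent : Graph N → ℕ → Set
HasIndependent {N} H n = ∃ λ I → length I ≡ n × AllPairs (NonAdj H) I

isRed : Colour → Bool
isRed red = true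
isRed blue = false

redGraph : (G : Graph N) → Colouring G → Graph N
redGraph G c .adj u v = adj G u v ∧ isRed (col c u v)
redGraph G c .symm u v = cong₂ _∧_ (symm G u v) (cong isRed (csym c u v))
redGraph G c .irrefl u = cong (_∧ isRed (col c u u)) (irrefl G u)

red-adj : ∀ (G : Graph N) (c : Colouring G) {u v} → adj (redGraph G c) u v ≡ true → adj G u v ≡ true × col c u v ≡ red
red-adj G c {u} {v} uv with adj G u v | col c u v
... | true | red = refl , refl

union : Graph N → Graph N → Graph N
union G H .adj u v = adj G u v ∨ adj H u v
union G H .symm u v = cong₂ _∨_ (symm G u v) (symm H u v)
union G H .irrefl u = cong₂ _∨_ (irrefl G u) (irrefl H u)

deg-union : ∀ (G H : Graph N) v L → deg (union G H) v L ≤ deg G v L + deg H v L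
deg-union G H v [] = z≤n
deg-union G H v (u ∷ L) = ≤-trans (+-mono-≤ (or (adj G v u) (adj H v u)) (deg-union G H v L))
  (≤-reflexive (interchange ⟦ adj G v u ⟧ _ _ _))
  where
  or : ∀ a b → ⟦ a ∨ b ⟧ ≤ ⟦ a ⟧ + ⟦ b ⟧
  or true b = s≤s z≤n
  or false b = ≤-refl

-- Without a red star the red graph has all degrees below k. A set independent both in M and in the
-- red graph is a clique in the complement of M, with all its edges blue.
arrows-complement : ∀ (M : Graph N) k n →
  (∀ Q → (∀ v → deg Q v (allFin N) < k) → HasIndependent (union M Q) n) → Arrows k n (complement M)
arrows-complement {N} M k n indep c with Fin.any? (λ v → k ≤? deg (redGraph (complement M) c) v (allFin N))
... | yes (v , k≤d)
  with S , T , σ , |S| , star ← extract (adj (redGraph (complement M) c) v) k (allFin N) k≤d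
  with f , inj , _ , f∈ ← enumerate S |S| (_∘ sym) (λ x≢x → x≢x refl)
    (allPairs-++⁻ˡ S (≢-resp-↭ σ (AllPairs.tabulate⁺ id)))
  = inj₁ (v , f , inj , λ i → red-adj (complement M) c (All.lookup star (f∈ i)))
... | no low
  with I , |I| , h ← indep (redGraph (complement M) c) (λ v → ≰⇒> λ k≤d → low (v , k≤d))
  with f , inj , ind , _ ← enumerate I |I| (nonAdj-sym (union M (redGraph (complement M) c))) (λ x≁x → proj₁ x≁x refl) h
  = inj₂ (f , inj , λ i j i≢j → blueAdj (ind i j i≢j))
  where
  blueAdj : ∀ {u v} → NonAdj (union M (redGraph (complement M) c)) u v → adj (complement M) u v ≡ true × col c u v ≡ blue
  blueAdj {u} {v} (u≢v , uv) rewrite adj-complement M u≢v with adj M u v | col c u v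
  ... | false | blue = refl , refl

-- Greedy search for independent sets.

record Greedy (H : Graph N) (a b : ℕ) : Set where
  field
    -- I holds the picked vertices, X the vertices used up (picks together with their neighbours), W
    -- those still available.
    I X W : List (Fin N)
    perm : allFin N ↭ X ++ W
    |I| : length I ≡ a
    |X| : length X ≤ b
    indep : AllPairs (NonAdj H) I
    free : All (λ w → All (NonAdj H w) I) W

  distinct : AllPairs _≢_ W
  distinct = allPairs-++⁻ʳ X (≢-resp-↭ perm (AllPairs.tabulate⁺ id))

  size : length X + length W ≡ N
  size = trans (sym (length-++ X)) (trans (sym (↭-length perm)) (length-allFin N))

  count-parts : ∀ p → count p X + count p W ≡ count p (allFin N)
  count-parts p = sym (trans (count-↭ p perm) (count-++ p X W))

  deg≤ : ∀ w → deg H w W ≤ deg H w (allFin N)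
  deg≤ w = ≤-trans (m≤n+m _ _) (≤-reflexive (count-parts (adj H w)))

greedy-start : ∀ (H : Graph N) → Greedy H 0 0
greedy-start {N} H = record
  { I = [] ; X = [] ; W = allFin N ; perm = ↭-refl ; |I| = refl ; |X| = z≤n ; indep = []
  ; free = All.tabulate λ _ → [] }

-- The cost is one plus the degree within W only, since neighbours in X are already used up. The
-- equation on I lets a caller keep track of an earlier pick.
greedy-pick : ∀ {H : Graph N} {a b} (s : Greedy H a b) → let open Greedy s in ∀ {w} → w ∈ W →
  ∀ {c} → b + suc (deg H w W) ≤ c → ∃ λ (s′ : Greedy H (suc a) c) → Greedy.I s′ ≡ w ∷ I
greedy-pick {N} {H} {a} {b} s {w} w∈ {c} b≤c
  with W′ , σ ← pull w∈
  with C , W″ , τ , |C| , off ← split (adj H w) W′ = s′ , refl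
  where
  open Greedy s
  ρ : W ↭ w ∷ C ++ W″
  ρ = ↭-trans σ (prep w τ)
  w≢ : All (w ≢_) W″
  w≢ with h ∷ _ ← ≢-resp-↭ ρ distinct = All.++⁻ʳ C h
  freeρ : All (λ u → All (NonAdj H u) I) (w ∷ C ++ W″)
  freeρ = All-resp-↭ ρ free
  s′ : Greedy H (suc a) c
  s′ .Greedy.I = w ∷ I
  s′ .Greedy.X = X ++ w ∷ C
  s′ .Greedy.W = W″
  s′ .Greedy.perm = ↭-trans perm (↭-trans (++⁺ˡ X ρ) (↭-reflexive (sym (++-assoc X (w ∷ C) W″))))
  s′ .Greedy.|I| = cong suc |I|
  s′ .Greedy.|X| = begin
    length (X ++ w ∷ C) ≡⟨ length-++ X ⟩
    length X + suc (length C) ≤⟨ +-mono-≤ |X| (s≤s (≤-reflexive (trans |C|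
      (trans (sym (deg-self H w W′)) (sym (count-↭ (adj H w) σ)))))) ⟩
    b + suc (deg H w W) ≤⟨ b≤c ⟩
    c ∎
    where open ≤-Reasoning
  s′ .Greedy.indep = All.lookup freeρ (here refl) ∷ indep
  s′ .Greedy.free = All.tabulate λ u∈ →
    nonAdj-sym H (All.lookup w≢ u∈ , All.lookup off u∈) ∷ All.lookup freeρ (there (Any.++⁺ʳ C u∈))

greedy-independent : ∀ {H : Graph N} {a b} → Greedy H a b → HasIndependent H a
greedy-independent s = Greedy.I s , Greedy.|I| s , Greedy.indep s

remaining : ∀ {H : Graph N} {a b} (s : Greedy H a b) → ∀ m → b + m ≤ N → m ≤ length (Greedy.W s)
remaining {N} {b = b} s m b+m≤N = +-cancelˡ-≤ b _ _ (begin
  b + m ≤⟨ b+m≤N ⟩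
  N ≡⟨ size ⟨
  length X + length W ≤⟨ +-monoˡ-≤ _ |X| ⟩
  b + length W ∎)
  where
  open ≤-Reasoning
  open Greedy s

inhabited : ∀ {L : List A} → 1 ≤ length L → ∃ λ x → x ∈ L
inhabited {L = x ∷ L} _ = x , here refl

-- The at most k vertices of larger degree are only used for the last pick.
independent-few-high : ∀ (H : Graph N) (p : Fin N → Bool) k n → N ≡ k * n + 1 → count p (allFin N) ≤ k →
  (∀ w → p w ≡ false → deg H w (allFin N) < k) → HasIndependent H (suc n)
independent-few-high {N} H p k n N≡ few low = finish (go n ≤-refl)
  where
  -- Before the last pick more than k vertices remain, so one of them fails p and costs at most k.
  enough : ∀ a → a < n → a * k + suc k ≤ N
  enough a a<n = begin
    a * k + suc k ≡⟨ rearrange a k ⟩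
    k * suc a + 1 ≤⟨ +-monoˡ-≤ 1 (*-monoʳ-≤ k a<n) ⟩
    k * n + 1 ≡⟨ N≡ ⟨
    N ∎
    where
    open ≤-Reasoning
    rearrange : ∀ a k → a * k + suc k ≡ k * suc a + 1
    rearrange = solve-∀
  go : ∀ a → a ≤ n → Greedy H a (a * k)
  go zero _ = greedy-start H
  go (suc a) a<n
    with s ← go a (<⇒≤ a<n)
    with w , w∈ , pw ← ∃-false p (Greedy.W s) (≤-trans (s≤s (m+n≤o⇒n≤o _ (≤-trans (≤-reflexive (Greedy.count-parts s p)) few)))
      (remaining s (suc k) (enough a a<n)))
    = proj₁ (greedy-pick s w∈ (≤-trans (+-monoʳ-≤ (a * k) (≤-trans (s≤s (Greedy.deg≤ s w)) (low w pw)))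
        (≤-reflexive (+-comm (a * k) k))))
  finish : Greedy H n (n * k) → HasIndependent H (suc n)
  -- The n picks use up at most nk = N - 1 vertices, so one remains; nothing has to be left over
  -- after it.
  finish s with w , w∈ ← inhabited (remaining s 1 (≤-reflexive (trans (cong (_+ 1) (*-comm n k)) (sym N≡)))) =
    greedy-independent (proj₁ (greedy-pick s w∈ ≤-refl))

-- A pick removes at most k vertices if it has a neighbour among the removed ones. Otherwise the
-- remaining vertices are matched among themselves, so evenly many remain, while N is odd and k even:
-- the bound on the removed vertices is not attained, and the next pick may remove k + 1 vertices.
independent-matching : ∀ (H M : Graph N) z j n → let k = j * 2 in N ≡ k * n + 1 →
  (∀ {u v} → adj M u v ≡ true → adj H u v ≡ true) → (∀ w → w ≢ z → deg M w (allFin N) ≡ 1) →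
  (∀ w → deg H w (allFin N) ≤ k) → deg H z (allFin N) < k → HasIndependent H (suc n)
independent-matching {N} H M z j n N≡ M⊆H matched bounded zlow = greedy-independent (proj₁ (go n ≤-refl))
  where
  k : ℕ
  k = j * 2

  State : ℕ → Set
  State a = ∃ λ (s : Greedy H a (a * k)) → z ∈ Greedy.I s

  deg-M≤ : ∀ w L → deg M w L ≤ deg H w L
  deg-M≤ w = count-mono (adj M w) (adj H w) λ u → sub (M⊆H {w} {u})
    where
    sub : ∀ {a b} → (a ≡ true → b ≡ true) → ⟦ a ⟧ ≤ ⟦ b ⟧
    sub {true} h rewrite h refl = ≤-refl
    sub {false} h = z≤n

  even-remaining : ∀ {a b} (s : Greedy H a b) → z ∈ Greedy.I s → ¬ Any (λ w → 1 ≤ deg H w (Greedy.X s)) (Greedy.W s) →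
    2 * edges M (Greedy.W s) ≡ length (Greedy.W s)
  even-remaining s z∈ closed = trans (sym (handshake M W)) (trans (sum-map-const _ 1 W inner) (*-identityʳ _))
    where
    open Greedy s
    inner : ∀ {w} → w ∈ W → deg M w W ≡ 1
    inner {w} w∈ = trans (cong (_+ deg M w W) (sym none))
      (trans (count-parts (adj M w)) (matched w (proj₁ (All.lookup (All.lookup free w∈) z∈))))
      where
      none : deg M w X ≡ 0
      none = n≤0⇒n≡0 (≤-trans (deg-M≤ w X) (≤-pred (≰⇒> (All.lookup (All.¬Any⇒All¬ W closed) w∈))))

  slack : ∀ {a} (s : Greedy H a (a * k)) → 2 * edges M (Greedy.W s) ≡ length (Greedy.W s) → length (Greedy.X s) < a * k
  slack {a} s even = ≤∧≢⇒< |X| λ eq → even≢odd (a * j + edges M W) (j * n) (begin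
    2 * (a * j + edges M W) ≡⟨ left a j (edges M W) ⟩
    a * (j * 2) + 2 * edges M W ≡⟨ cong₂ _+_ (sym eq) even ⟩
    length X + length W ≡⟨ trans size N≡ ⟩
    j * 2 * n + 1 ≡⟨ right j n ⟩
    suc (2 * (j * n)) ∎)
    where
    open Greedy s
    open ≡-Reasoning
    left : ∀ a j m → 2 * (a * j + m) ≡ a * (j * 2) + 2 * m
    left = solve-∀
    right : ∀ j n → j * 2 * n + 1 ≡ suc (2 * (j * n))
    right = solve-∀

  step : ∀ {a} → a ≤ n → State a → State (suc a)
  step {a} a≤n (s , z∈) with Any.any? (λ w → 1 ≤? deg H w (Greedy.X s)) (Greedy.W s)
  ... | yes blocked
    with w , w∈ , d ← find blocked
    with s′ , eq ← greedy-pick s w∈ (≤-trans (+-monoʳ-≤ (a * k) (≤-trans (+-monoˡ-≤ _ d)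
      (≤-trans (≤-reflexive (Greedy.count-parts s (adj H w))) (bounded w)))) (≤-reflexive (+-comm (a * k) k)))
    = s′ , subst (z ∈_) (sym eq) (there z∈)
  ... | no closed
    with w , w∈ ← inhabited (remaining s 1 (≤-trans (+-monoˡ-≤ 1 (≤-trans (*-monoˡ-≤ k a≤n) (≤-reflexive (*-comm n k))))
      (≤-reflexive (sym N≡))))
    -- The bound is first tightened to the exact size of X, so that the spare vertex from `slack`
    -- pays for a pick of cost k + 1.
    with s′ , eq ← greedy-pick (record { Greedy s ; |X| = ≤-refl }) w∈ (≤-trans
      (≤-reflexive (+-suc (length (Greedy.X s)) _))
      (≤-trans (+-mono-≤ (slack s (even-remaining s z∈ closed)) (≤-trans (Greedy.deg≤ s w) (bounded w)))
        (≤-reflexive (+-comm (a * k) k))))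
    = s′ , subst (z ∈_) (sym eq) (there z∈)

  go : ∀ a → a ≤ n → State (suc a)
  -- The vertex z goes first: its degree is below k, and afterwards every available vertex differs
  -- from z and so is matched.
  go zero _ with s′ , eq ← greedy-pick (greedy-start H) (∈-allFin z) (≤-trans zlow (≤-reflexive (sym (+-identityʳ k))))
    = s′ , subst (z ∈_) (sym eq) (here refl)
  go (suc a) a<n = step a<n (go a (<⇒≤ a<n))

-- Arrowing graphs on R vertices with few edges.

deg-cong : ∀ {G H : Graph N} → (∀ u v → adj G u v ≡ adj H u v) → ∀ v L → deg G v L ≡ deg H v L
deg-cong eq v = count-cong (eq v)

edges-cong : ∀ {G H : Graph N} → (∀ u v → adj G u v ≡ adj H u v) → ∀ L → edges G L ≡ edges H L
edges-cong eq [] = refl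
edges-cong {G = G} {H} eq (v ∷ L) = cong₂ _+_ (deg-cong {G = G} {H} eq v L) (edges-cong {G = G} {H} eq L)

e-complement : ∀ (M : Graph N) → e (complement M) + edges M (allFin N) ≡ pairs N
e-complement {N} M = trans (cong (e (complement M) +_)
  (sym (edges-cong {G = complement (complement M)} {M} (complement-involutive M) (allFin N)))) (e+edges-complement (complement M))

edges-++-≥ : ∀ (G : Graph N) S T → edges G S ≤ edges G (S ++ T)
edges-++-≥ G [] T = z≤n
edges-++-≥ G (v ∷ S) T = +-mono-≤ (≤-trans (m≤m+n _ _) (≤-reflexive (sym (count-++ (adj G v) S T)))) (edges-++-≥ G S T)

≟-sym : ∀ (u v : Fin N) → ⌊ u Fin.≟ v ⌋ ≡ ⌊ v Fin.≟ u ⌋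
≟-sym u v with u Fin.≟ v | v Fin.≟ u
... | yes _ | yes _ = refl
... | no _ | no _ = refl
... | yes p | no q = ⊥-elim (q (sym p))
... | no p | yes q = ⊥-elim (p (sym q))

cliqueOn : (Fin N → Bool) → Graph N
cliqueOn p .adj u v = (p u ∧ p v) ∧ not ⌊ u Fin.≟ v ⌋
cliqueOn p .symm u v = cong₂ _∧_ (Bool.∧-comm (p u) (p v)) (cong not (≟-sym u v))
cliqueOn p .irrefl u with u Fin.≟ u
... | yes _ = Bool.∧-zeroʳ _
... | no u≢u = ⊥-elim (u≢u refl)

edges-cliqueOn : ∀ (p : Fin N → Bool) {S} → All (λ v → p v ≡ true) S → AllPairs _≢_ S →
  edges (cliqueOn p) S ≡ pairs (length S)
edges-cliqueOn p [] [] = refl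
edges-cliqueOn {N} p {v ∷ _} (pv ∷ ps) (h ∷ hs) = cong₂ _+_ (full _ ps h) (edges-cliqueOn p ps hs)
  where
  full : ∀ S → All (λ u → p u ≡ true) S → All (v ≢_) S → deg (cliqueOn p) v S ≡ length S
  full [] [] [] = refl
  full (u ∷ S) (pu ∷ ps) (v≢u ∷ h) = cong₂ _+_ (cong ⟦_⟧ joined) (full S ps h)
    where
    joined : adj (cliqueOn p) v u ≡ true
    joined with v Fin.≟ u
    ... | yes v≡u = ⊥-elim (v≢u v≡u)
    ... | no _ rewrite pv | pu = refl

count-below : ∀ N k → count (λ u → toℕ u <ᵇ k) (allFin N) ≡ k ⊓ N
count-below zero k = sym (⊓-zeroʳ k)
count-below (suc N) zero = count-none _ (allFin (suc N)) λ _ → refl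
count-below (suc N) (suc k) = cong suc (begin
  count p (tabulate Fin.suc) ≡⟨ cong (count p) (map-tabulate id Fin.suc) ⟨
  count p (map Fin.suc (allFin N)) ≡⟨ cong sum (map-∘ {g = λ u → ⟦ p u ⟧} {f = Fin.suc} (allFin N)) ⟨
  count (λ u → toℕ u <ᵇ k) (allFin N) ≡⟨ count-below N k ⟩
  k ⊓ N ∎)
  where
  open ≡-Reasoning
  p : Fin (suc N) → Bool
  p u = toℕ u <ᵇ suc k

-- Outside the deleted clique, degrees in the union are at most those in Q, hence below k; only the
-- k clique vertices can exceed this.
few-edges-clique : ∀ k n → k ≤ k * n + 1 → ∃ λ (F : Graph (k * n + 1)) → Arrows k (suc n) F × e F + pairs k ≤ pairs (k * n + 1)
few-edges-clique k n k≤N = complement M , arrows-complement M k (suc n) indep , (begin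
  e (complement M) + pairs k ≤⟨ +-monoʳ-≤ (e (complement M)) enough ⟩
  e (complement M) + edges M (allFin R) ≡⟨ e-complement M ⟩
  pairs R ∎)
  where
  open ≤-Reasoning
  R : ℕ
  R = k * n + 1
  p : Fin R → Bool
  p u = toℕ u <ᵇ k
  M : Graph R
  M = cliqueOn p
  |p| : count p (allFin R) ≡ k
  |p| = trans (count-below R k) (m≤n⇒m⊓n≡m k≤N)
  enough : pairs k ≤ edges M (allFin R)
  enough with S , T , σ , |S| , ps ← extract p k (allFin R) (≤-reflexive (sym |p|)) = begin
    pairs k ≡⟨ cong pairs |S| ⟨
    pairs (length S) ≡⟨ edges-cliqueOn p ps (allPairs-++⁻ˡ S (≢-resp-↭ σ (AllPairs.tabulate⁺ id))) ⟨
    edges M S ≤⟨ edges-++-≥ M S T ⟩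
    edges M (S ++ T) ≡⟨ edges-↭ M σ ⟨
    edges M (allFin R) ∎
  indep : ∀ Q → (∀ v → deg Q v (allFin R) < k) → HasIndependent (union M Q) (suc n)
  indep Q low = independent-few-high (union M Q) p k n refl (≤-reflexive |p|) λ w pw →
    ≤-<-trans (≤-trans (deg-union M Q w (allFin R)) (≤-reflexive (cong (_+ deg Q w (allFin R)) (count-none (adj M w) (allFin R)
      λ {u} _ → cong (λ b → (b ∧ p u) ∧ not ⌊ w Fin.≟ u ⌋) pw)))) (low w)

count-≡ : ∀ {L} (x : Fin N) → AllPairs _≢_ L → x ∈ L → count (λ y → ⌊ x Fin.≟ y ⌋) L ≡ 1
count-≡ {L = L} x distinct x∈ with M , σ ← pull x∈ with x≢ ∷ _ ← ≢-resp-↭ σ distinct =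
  trans (count-↭ _ σ) (cong₂ _+_ self (count-none _ M λ y∈ → other (All.lookup x≢ y∈)))
  where
  self : ⟦ ⌊ x Fin.≟ x ⌋ ⟧ ≡ 1
  self with x Fin.≟ x
  ... | yes _ = refl
  ... | no x≢x = ⊥-elim (x≢x refl)
  other : ∀ {y} → x ≢ y → ⌊ x Fin.≟ y ⌋ ≡ false
  other {y} x≢y with x Fin.≟ y
  ... | yes x≡y = ⊥-elim (x≢y x≡y)
  ... | no _ = refl

-- The matching of u with N - 1 - u. The second factor removes the loop at the middle vertex when N
-- is odd.
mirror : ∀ N → Graph N
mirror N .adj u v = ⌊ Fin.opposite u Fin.≟ v ⌋ ∧ not ⌊ u Fin.≟ v ⌋
mirror N .symm u v = cong₂ _∧_ flip (cong not (≟-sym u v))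
  where
  flip : ⌊ Fin.opposite u Fin.≟ v ⌋ ≡ ⌊ Fin.opposite v Fin.≟ u ⌋
  flip with Fin.opposite u Fin.≟ v | Fin.opposite v Fin.≟ u
  ... | yes _ | yes _ = refl
  ... | no _ | no _ = refl
  ... | yes refl | no q = ⊥-elim (q (Fin.opposite-involutive u))
  ... | no p | yes refl = ⊥-elim (p (Fin.opposite-involutive v))
mirror N .irrefl u with u Fin.≟ u
... | yes _ = Bool.∧-zeroʳ _
... | no u≢u = ⊥-elim (u≢u refl)

mirror-unmatched : ∀ (u : Fin N) → Fin.opposite u ≡ u → ∀ L → deg (mirror N) u L ≡ 0
mirror-unmatched u fixed L = count-none _ L λ {v} _ →
  subst (λ w → ⌊ w Fin.≟ v ⌋ ∧ not ⌊ u Fin.≟ v ⌋ ≡ false) (sym fixed) (Bool.∧-inverseʳ ⌊ u Fin.≟ v ⌋)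

mirror-matched : ∀ (u : Fin N) → Fin.opposite u ≢ u → deg (mirror N) u (allFin N) ≡ 1
mirror-matched {N} u moved = trans (count-cong partner (allFin N)) (count-≡ (Fin.opposite u) (AllPairs.tabulate⁺ id) (∈-allFin _))
  where
  partner : ∀ v → adj (mirror N) u v ≡ ⌊ Fin.opposite u Fin.≟ v ⌋
  partner v with Fin.opposite u Fin.≟ v | u Fin.≟ v
  ... | yes p | yes q = ⊥-elim (moved (trans p (sym q)))
  ... | yes _ | no _ = refl
  ... | no _ | _ = refl

-- As k is even, R = 2p + 1 is odd, and `mirror` leaves only the middle vertex z unmatched. Deleting
-- it raises the degrees of Q by at most one, and not at z.
few-edges-matching : ∀ j n → let k = suc j * 2 in
  ∃ λ (F : Graph (k * n + 1)) → Arrows k (suc n) F × e F + suc j * n ≤ pairs (k * n + 1)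
few-edges-matching j n = complement M , arrows-complement M k (suc n) indep , (begin
  e (complement M) + suc j * n ≤⟨ +-monoʳ-≤ (e (complement M)) enough ⟩
  e (complement M) + edges M (allFin R) ≡⟨ e-complement M ⟩
  pairs R ∎)
  where
  open ≤-Reasoning
  k p R : ℕ
  k = suc j * 2
  p = suc j * n
  R = k * n + 1
  M : Graph R
  M = mirror R
  R≡ : R ≡ suc p + p
  R≡ = odd (suc j) n
    where
    odd : ∀ j n → j * 2 * n + 1 ≡ suc (j * n) + j * n
    odd = solve-∀
  p<R : p < R
  p<R = ≤-trans (m≤m+n (suc p) p) (≤-reflexive (sym R≡))
  z : Fin R
  z = Fin.fromℕ< p<R
  fixed : Fin.opposite z ≡ z
  fixed = Fin.toℕ-injective (begin-equality
    toℕ (Fin.opposite z) ≡⟨ Fin.opposite-prop z ⟩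
    R ∸ suc (toℕ z) ≡⟨ cong₂ (λ a b → a ∸ suc b) R≡ (Fin.toℕ-fromℕ< p<R) ⟩
    suc p + p ∸ suc p ≡⟨ m+n∸m≡n (suc p) p ⟩
    p ≡⟨ Fin.toℕ-fromℕ< p<R ⟨
    toℕ z ∎)
  fixed⇒z : ∀ u → Fin.opposite u ≡ u → u ≡ z
  fixed⇒z u eq = Fin.toℕ-injective (trans (*-cancelˡ-≡ (toℕ u) p 2 (suc-injective (begin-equality
    suc (2 * toℕ u) ≡⟨ double (toℕ u) ⟩
    suc (toℕ u) + toℕ u ≡⟨ cong (suc (toℕ u) +_) (trans (cong toℕ (sym eq)) (Fin.opposite-prop u)) ⟩
    suc (toℕ u) + (R ∸ suc (toℕ u)) ≡⟨ m+[n∸m]≡n (Fin.toℕ<n u) ⟩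
    R ≡⟨ R≡ ⟩
    suc p + p ≡⟨ double p ⟨
    suc (2 * p) ∎))) (sym (Fin.toℕ-fromℕ< p<R)))
    where
    double : ∀ m → suc (2 * m) ≡ suc m + m
    double = solve-∀
  matched : ∀ w → w ≢ z → deg M w (allFin R) ≡ 1
  matched w w≢z = mirror-matched w (w≢z ∘ fixed⇒z w)
  deg-M≤1 : ∀ w → deg M w (allFin R) ≤ 1
  deg-M≤1 w with w Fin.≟ z
  ... | yes refl = ≤-trans (≤-reflexive (mirror-unmatched z fixed (allFin R))) z≤n
  ... | no w≢z = ≤-reflexive (matched w w≢z)
  enough : p ≤ edges M (allFin R)
  -- The 2p vertices other than z have degree 1 each, so by the handshake lemma there are at least p
  -- edges.
  enough with L , σ ← pull (∈-allFin z) with z≢ ∷ _ ← ≢-resp-↭ σ (AllPairs.tabulate⁺ id) =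
    *-cancelˡ-≤ 2 (≤-pred (begin
      suc (2 * p) ≡⟨ cong (suc p +_) (+-identityʳ p) ⟩
      suc p + p ≡⟨ R≡ ⟨
      R ≡⟨ trans (sym (length-allFin R)) (↭-length σ) ⟩
      suc (length L) ≡⟨ cong suc (*-identityʳ (length L)) ⟨
      suc (length L * 1) ≡⟨ cong suc (sum-map-const (λ w → deg M w (allFin R)) 1 L
        (λ {w} w∈ → matched w (All.lookup z≢ w∈ ∘ sym))) ⟨
      suc (sum (map (λ w → deg M w (allFin R)) L)) ≤⟨ s≤s (m≤n+m _ (deg M z (allFin R))) ⟩
      suc (sum (map (λ w → deg M w (allFin R)) (z ∷ L))) ≡⟨ cong suc (sum-↭ (map⁺ _ σ)) ⟨
      suc (sum (map (λ w → deg M w (allFin R)) (allFin R))) ≡⟨ cong suc (handshake M (allFin R)) ⟩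
      suc (2 * edges M (allFin R)) ∎))
  indep : ∀ Q → (∀ v → deg Q v (allFin R) < k) → HasIndependent (union M Q) (suc n)
  indep Q low = independent-matching (union M Q) M z (suc j) n refl (λ {u} {v} uv → cong (_∨ adj Q u v) uv) matched
    (λ w → ≤-trans (deg-union M Q w (allFin R)) (≤-trans (+-monoˡ-≤ _ (deg-M≤1 w)) (low w)))
    (≤-<-trans (≤-trans (deg-union M Q z (allFin R))
      (≤-reflexive (cong (_+ deg Q z (allFin R)) (mirror-unmatched z fixed (allFin R))))) (low z))

-- Consequences of the bound on ℓ, and comparison of edge counts.

blocks-fit : ∀ k₀ n ℓ → let k = suc k₀ in ℓ * (suc k * suc k) + 2 * k * k ≤ k * suc n → suc k * (ℓ * suc k + k₀) ≤ k * n + 1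
-- The claim is (k + 1)Δ ≤ R, as `pack` requires. The added constant is k² + 1 = 2k² - (k + 1)(k -
-- 1), with one k split off to match k(n + 1) = kn + k.
blocks-fit k₀ n ℓ h = +-cancelʳ-≤ (suc k₀ + (k₀ * k₀ + k₀ + 1)) _ _ (begin
  suc k * (ℓ * suc k + k₀) + (suc k₀ + (k₀ * k₀ + k₀ + 1)) ≡⟨ left k₀ ℓ ⟩
  ℓ * (suc k * suc k) + 2 * k * k ≤⟨ h ⟩
  k * suc n ≡⟨ right k₀ n ⟩
  k * n + suc k₀ ≤⟨ +-mono-≤ (m≤m+n (k * n) 1) (m≤m+n (suc k₀) _) ⟩
  k * n + 1 + (suc k₀ + (k₀ * k₀ + k₀ + 1)) ∎)
  where
  open ≤-Reasoning
  k : ℕ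
  k = suc k₀
  left : ∀ k₀ ℓ → suc (suc k₀) * (ℓ * suc (suc k₀) + k₀) + (suc k₀ + (k₀ * k₀ + k₀ + 1))
    ≡ ℓ * (suc (suc k₀) * suc (suc k₀)) + 2 * suc k₀ * suc k₀
  left = solve-∀
  right : ∀ k₀ n → suc k₀ * suc n ≡ suc k₀ * n + suc k₀
  right = solve-∀

-- Ensures that ℓ + 1 blocks do not exceed the n classes available, so that p = n - ℓ - 1 classes
-- are left for k-sets.
few-blocks : ∀ k₀ n ℓ → let k = suc k₀ in ℓ * (suc k * suc k) + 2 * k * k ≤ k * suc n → suc ℓ ≤ n
few-blocks k₀ n ℓ h = ≤-pred (≤-trans (≤-reflexive (+-comm 2 ℓ)) (≤-trans (+-monoʳ-≤ ℓ (*-monoʳ-≤ 2 (s≤s z≤n)))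
  (*-cancelˡ-≤ {ℓ + 2 * k} k (begin
    k * (ℓ + 2 * k) ≤⟨ m≤m+n _ (ℓ * (k * k + k + 1)) ⟩
    k * (ℓ + 2 * k) + ℓ * (k * k + k + 1) ≡⟨ expand k ℓ ⟩
    ℓ * (suc k * suc k) + 2 * k * k ≤⟨ h ⟩
    k * suc n ∎))))
  where
  open ≤-Reasoning
  k : ℕ
  k = suc k₀
  expand : ∀ k ℓ → k * (ℓ + 2 * k) + ℓ * (k * k + k + 1) ≡ ℓ * (suc k * suc k) + 2 * k * k
  expand = solve-∀

-- Compared with n classes of size k there are ℓ + 1 vertices too many; each of the ℓ + 1 blocks
-- absorbs one.
length-rest : ∀ {k p ℓ} (Ls : List (List A)) T → length Ls ≡ suc ℓ → All (λ S → length S ≡ suc k) Ls →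
  k * (suc ℓ + p) + 1 + ℓ ≡ length (concat Ls ++ T) → length T ≡ p * k
length-rest {k = k} {p} {ℓ} Ls T |Ls| hLs eq = +-cancelˡ-≡ (suc ℓ * suc k) _ _ (begin
  suc ℓ * suc k + length T ≡⟨ cong (λ m → m * suc k + length T) |Ls| ⟨
  length Ls * suc k + length T ≡⟨ cong (_+ length T) (length-concat (suc k) Ls hLs) ⟨
  length (concat Ls) + length T ≡⟨ length-++ (concat Ls) ⟨
  length (concat Ls ++ T) ≡⟨ eq ⟨
  k * (suc ℓ + p) + 1 + ℓ ≡⟨ regroup k p ℓ ⟩
  suc ℓ * suc k + p * k ∎)
  where
  open ≡-Reasoning
  regroup : ∀ k p ℓ → k * (suc ℓ + p) + 1 + ℓ ≡ suc ℓ * suc k + p * k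
  regroup = solve-∀

-- With more nonedges, `pack` at q = ℓ would give the ℓ + 1 blocks of a forbidden partition into n
-- classes. At ℓ = 0 the bound says that there are at most B nonedges.
nonedges-bound : ∀ k₀ n ℓ B → let k = suc k₀; R = k * n + 1 in (G : Graph (R + ℓ)) →
  suc k * (ℓ * suc k + k₀) ≤ R → suc ℓ ≤ n →
  (∀ q W → length W ≤ q + R → pairs (q + R) + B < edges (complement G) W + pairs R → Block (complement G) (suc k) W) →
  Arrows k (suc n) G → edges (complement G) (allFin (R + ℓ)) + pairs R ≤ pairs (R + ℓ) + B
nonedges-bound k₀ n ℓ B G small ℓ<n block arrows
  with edges (complement G) (allFin (suc k₀ * n + 1 + ℓ)) + pairs (suc k₀ * n + 1) ≤? pairs (suc k₀ * n + 1 + ℓ) + B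
... | yes bound = bound
... | no many
  with p , refl ← m≤n⇒∃[o]m+o≡n ℓ<n
  with Ls , T , σ , |Ls| , hLs ← pack (complement G) k₀ ℓ (suc k₀ * n + 1) B small block ℓ (allFin _) ≤-refl
    (≤-reflexive (trans (length-allFin _) (+-comm _ ℓ)))
    (≤-<-trans (≤-reflexive (cong (λ m → pairs m + B) (+-comm ℓ (suc k₀ * (suc ℓ + p) + 1)))) (≰⇒> many))
  with Cs , |Cs| , refl , hCs ← chop (suc k₀) p T (≤-reflexive (length-rest Ls T |Ls| (All.map proj₁ hLs)
    (trans (sym (length-allFin _)) (↭-length σ))))
  = ⊥-elim (¬arrows G (suc k₀) (suc n) (Ls ++ Cs)
      (s≤s (≤-reflexive (trans (length-++ Ls) (cong₂ _+_ |Ls| |Cs|))))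
      (λ v → ∈-concat⁻ (Ls ++ Cs) (subst (v ∈_) (concat-++ Ls Cs) (∈-resp-↭ σ (∈-allFin v))))
      (All.++⁺ (All.map (λ { (|S| , h) _ → deg-block G |S| h }) hLs) (All.map (λ |S| _ → deg-short G |S|) hCs))
      arrows)

-- With c nonedges, e G = C(R + ℓ, 2) - c ≥ C(R, 2) - B ≥ e F; a common summand on both sides avoids
-- subtraction.
e-compare : ∀ {R ℓ B} (F : Graph R) (G : Graph (R + ℓ)) → e F + B ≤ pairs R →
  edges (complement G) (allFin (R + ℓ)) + pairs R ≤ pairs (R + ℓ) + B → e F ≤ e G
e-compare {R} {ℓ} {B} F G few bound = +-cancelʳ-≤ (pairs R + B + c) _ _ (begin
  e F + (pairs R + B + c) ≡⟨ left (e F) (pairs R) B c ⟩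
  e F + B + (c + pairs R) ≤⟨ +-mono-≤ few bound ⟩
  pairs R + (pairs (R + ℓ) + B) ≡⟨ cong (λ m → pairs R + (m + B)) (e+edges-complement G) ⟨
  pairs R + (e G + c + B) ≡⟨ right (e G) (pairs R) B c ⟩
  e G + (pairs R + B + c) ∎)
  where
  open ≤-Reasoning
  c : ℕ
  c = edges (complement G) (allFin (R + ℓ))
  left : ∀ f r b c → f + (r + b + c) ≡ f + b + (c + r)
  left = solve-∀
  right : ∀ g r b c → r + (g + c + b) ≡ g + (r + b + c)
  right = solve-∀

double-pairs : ∀ k → 2 * pairs (suc k) ≡ suc k * k
double-pairs zero = refl
double-pairs (suc k) = trans (*-distribˡ-+ 2 (suc k) (pairs (suc k)))
  (trans (cong (2 * suc k +_) (double-pairs k)) (expand k))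
  where
  expand : ∀ k → 2 * suc k + suc k * k ≡ suc (suc k) * suc k
  expand = solve-∀

-- For even k the deleted matching is at least as large as K_k, so exceeding its size also passes
-- the C(k, 2) threshold for growing a block.
pairs≤matching : ∀ j n → let k = suc j * 2 in k ≤ suc n → pairs k ≤ suc j * n
pairs≤matching j n k≤ = *-cancelˡ-≤ 2 (begin
  2 * pairs (suc (suc (j * 2))) ≡⟨ double-pairs (suc (j * 2)) ⟩
  suc j * 2 * suc (j * 2) ≤⟨ *-monoʳ-≤ (suc j * 2) (≤-pred k≤) ⟩
  suc j * 2 * n ≡⟨ regroup (suc j) n ⟩
  2 * (suc j * n) ∎)
  where
  open ≤-Reasoning
  regroup : ∀ j n → j * 2 * n ≡ 2 * (j * n)
  regroup = solve-∀

excess : ∀ q R {B m} → pairs (q + R) + B < m + pairs R → B < m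
excess q R {B} {m} big = +-cancelʳ-< (pairs R) B m (≤-<-trans (≤-trans (≤-reflexive (+-comm B (pairs R)))
  (+-monoˡ-≤ B (pairs-mono (m≤n+m R q)))) big)

-- For q = 0, m exceeds B ≥ (R - 1) / 2. For larger q the increment of `pairs` alone already forces
-- m ≥ w.
dense : ∀ q {R B m w} → R ≤ suc (2 * B) → w ≤ q + R → pairs (q + R) + B < m + pairs R → w < 2 * m
dense zero {R} {B} {m} {w} R≤ w≤ big = begin-strict
  w ≤⟨ ≤-trans w≤ R≤ ⟩
  suc (2 * B) <⟨ n<1+n _ ⟩
  2 + 2 * B ≡⟨ *-suc 2 B ⟨
  2 * suc B ≤⟨ *-monoʳ-≤ 2 (excess 0 R big) ⟩
  2 * m ∎
  where open ≤-Reasoning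
dense (suc q) {R} {B} {m} {w} R≤ w≤ big = begin-strict
  w ≤⟨ w≤ ⟩
  suc (q + R) ≤⟨ s≤s (m≤m+n (q + R) B) ⟩
  suc (q + R + B) ≤⟨ q+R+B<m ⟩
  m <⟨ m<m+n m (≤-<-trans z≤n q+R+B<m) ⟩
  m + m ≡⟨ cong (m +_) (+-identityʳ m) ⟨
  2 * m ∎
  where
  open ≤-Reasoning
  q+R+B<m : q + R + B < m
  q+R+B<m = excess q R (subst (_< m + pairs R) (regroup (q + R) (pairs (q + R)) B) big)
    where
    regroup : ∀ a b c → a + b + c ≡ b + (a + c)
    regroup = solve-∀

parity : ∀ k → ∃ λ j → k ≡ j * 2 ⊎ k ≡ suc (j * 2)
parity zero = 0 , inj₁ refl
parity (suc k) with parity k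
... | j , inj₁ refl = j , inj₂ refl
... | j , inj₂ refl = suc j , inj₁ refl

theorem5 : (k n : ℕ) → 2 ≤ k → 3 * k + 3 ≤ n →
    (ℓ : ℕ) → ℓ ≤ (k * n ∸ 2 * k * k) / (suc k * suc k) →
    (G : Graph (k * (n ∸ 1) + 1 + ℓ)) → Arrows k n G →
    (m : ℕ) → IsRestrictedSizeRamsey (k * (n ∸ 1) + 1) k n m →
    m ≤ e G
theorem5 (suc k₀) zero _ n≥ with () ← ≤-trans (m≤n+m 3 (3 * suc k₀)) n≥
theorem5 k@(suc k₀) (suc n) 2≤k n≥ ℓ ℓ≤ G arrows m (_ , minimal) = conclude (parity k)
  where
  R : ℕ
  R = k * n + 1

  3k≤n : 3 * k ≤ suc n
  3k≤n = m+n≤o⇒m≤o (3 * k) n≥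

  ℓ-bound : ℓ * (suc k * suc k) + 2 * k * k ≤ k * suc n
  -- Multiplying back removes the floor, and 2k ≤ n + 1 makes the truncated subtraction exact.
  ℓ-bound = begin
    ℓ * (suc k * suc k) + 2 * k * k
      ≤⟨ +-monoˡ-≤ _ (≤-trans (*-monoˡ-≤ (suc k * suc k) ℓ≤) (m/n*n≤m (k * suc n ∸ 2 * k * k) (suc k * suc k))) ⟩
    k * suc n ∸ 2 * k * k + 2 * k * k
      ≡⟨ m∸n+n≡m (≤-trans (≤-reflexive (*-comm (2 * k) k)) (*-monoʳ-≤ k (≤-trans (m≤n+m (2 * k) k) 3k≤n))) ⟩
    k * suc n ∎
    where open ≤-Reasoning

  k≤n : k ≤ suc n
  k≤n = m+n≤o⇒m≤o k 3k≤n

  k≤R : k ≤ R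
  k≤R = ≤-trans (m≤m*n k n {{>-nonZero (≤-trans (s≤s z≤n) (few-blocks k₀ n ℓ ℓ-bound))}}) (m≤m+n (k * n) 1)

  compare : ∀ {B} → (∃ λ (F : Graph R) → Arrows k (suc n) F × e F + B ≤ pairs R) →
    (∀ q W → length W ≤ q + R → pairs (q + R) + B < edges (complement G) W + pairs R → Block (complement G) (suc k) W) →
    m ≤ e G
  compare {B} (F , arrowsF , few) block = ≤-trans (minimal F arrowsF)
    (e-compare F G few (nonedges-bound k₀ n ℓ B G (blocks-fit k₀ n ℓ ℓ-bound) (few-blocks k₀ n ℓ ℓ-bound) block arrows))

  conclude : (∃ λ j → k ≡ j * 2 ⊎ k ≡ suc (j * 2)) → m ≤ e G
  -- For odd k, B = C(k, 2) is both the size of the deleted K_k and the threshold beyond which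
  -- `block-odd` finds a block.
  conclude (j , inj₂ odd) = compare
    (few-edges-clique k n k≤R)
    λ q W _ big → block-odd (complement G) k j odd (excess q R big)
  -- For even k, B = (k / 2)n = (R - 1) / 2 is the size of the deleted matching, the largest that R
  -- vertices admit; j = 0 would make k zero.
  conclude (suc j , inj₁ refl) = compare (few-edges-matching j n) λ q W W≤ big →
    block-path (complement G) k 2≤k
      (dense q (≤-reflexive (trans (+-comm (k * n) 1) (cong suc (regroup (suc j) n)))) W≤ big)
      (≤-<-trans (pairs≤matching j n k≤n) (excess q R big))
    where
    regroup : ∀ j n → j * 2 * n ≡ 2 * (j * n)
    regroup = solve-∀
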